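{- For every graph $G$ and every direction $f$ of $G$ the following assertions are equivalent: (i) The direction $f$ is countably determined in $G$. (ii) The direction $f$ is induced by a directional ray of $G$.
   Context: Graphs may be infinite of any cardinality. Countable means finite or countably infinite. A ray is a one-way infinite path; a tail of a ray is a subray. A direction of a graph $G$ is a map $f$ that assigns to every finite vertex set $X\subseteq V(G)$ a component $f(X)$ of $G-X$ such that $f(X)\supseteq f(X')$ whenever $X\subseteq X'$. Every ray $R\subseteq G$ induces a direction of $G$: the one sending each finite $X\subseteq V(G)$ to the unique component of $G-X$ that contains a tail of $R$. A directional choice in $G$ is a pair $(X,C)$ of a finite set $X\subseteq V(G)$ and a component $C$ of $G-X$. It distinguishes a direction $f$ from another direction $h$ if $f(X)=C$ and $h(X)\neq C$. A direction $f$ of $G$ is countably determined in $G$ if there is a countable set of directional choices in $G$ that distinguish $f$ from every other direction of $G$ (i.e. for every direction $h\ne f$ some directional choice in the set distinguishes $f$ from $h$). If $R\subseteq G$ is a ray, every finite initial segment of $R$, with vertex set $X$ say, defines the directional choice $(X,C)$ where $C$ is the component of $G-X$ that contains $R-X$. The ray $R$ is directional in $G$ if the direction induced by $R$ is distinguished from every other direction of $G$ by the directional choices defined by the finite initial segments of $R$. -}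

module Defs where

open import Data.List.Base using (List; applyUpTo)
open import Data.List.Membership.Propositional
  using () renaming (_∉_ to _∉ₗ_)
open import Data.List.Relation.Binary.Subset.Propositional
  using () renaming (_⊆_ to _⊆ₗ_)
open import Data.List.Relation.Binary.BagAndSetEquality
  using (_∼[_]_; set; [_]-Equality)
open import Data.Nat.Base using (ℕ; suc; _≤_)
open import Data.Product.Base using (Σ; ∃; _×_; _,_; proj₁)
open import Function.Bundles using (Injection)
open import Level using (Level; _⊔_) renaming (suc to lsuc)
open import Relation.Binary.Bundles using (Setoid)
open import Relation.Binary.Construct.Closure.ReflexiveTransitive using (Star)
import Relation.Binary.Construct.On as On
open import Relation.Binary.Definitions using (Irreflexive; Symmetric)
open import Relation.Binary.PropositionalEquality as ≡ using (_≡_)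
open import Relation.Nullary.Negation using (¬_)
open import Relation.Unary using (Pred; Satisfiable; _∈_; _⊆_; _≐_)
open import Relation.Unary.Properties using (≐-refl; ≐-sym; ≐-trans)

record Graph (ℓ : Level) : Set (lsuc ℓ) where
  field
    Vertex      : Set ℓ
    Adj         : Vertex → Vertex → Set ℓ
    adj-sym     : Symmetric Adj
    adj-irrefl  : Irreflexive _≡_ Adj

-- Countable means finite or countably infinite.
Countable : ∀ {a b} → Setoid a b → Set (a ⊔ b)
Countable S = Injection S (≡.setoid ℕ)

-- A finite vertex set is given by a list of its elements. Order and
-- repetitions play no role: lists are compared by _⊆ₗ_ or _∼[ set ]_ only.

module _ {ℓ : Level} (G : Graph ℓ) where
  open Graph G

  AdjAvoiding : List Vertex → Vertex → Vertex → Set ℓ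
  AdjAvoiding X u v = Adj u v × u ∉ₗ X × v ∉ₗ X

  -- Components of G - X. The walk in `connected` stays inside the component
  -- by `maximal`.
  record Component (X : List Vertex) : Set (lsuc ℓ) where
    field
      vertices   : Pred Vertex ℓ
      nonempty   : Satisfiable vertices
      avoids     : ∀ {v} → v ∈ vertices → v ∉ₗ X
      connected  : ∀ {u v} → u ∈ vertices → v ∈ vertices →
                   Star (AdjAvoiding X) u v
      maximal    : ∀ {u v} → u ∈ vertices → Star (AdjAvoiding X) u v →
                   v ∈ vertices

  open Component public using (vertices)

  -- `antitone` forces `at` to take equal values on lists with the same
  -- elements, so that a direction is a map on finite vertex sets.
  record Direction : Set (lsuc ℓ) where
    field
      at        : (X : List Vertex) → Component X
      antitone  : ∀ {X X′} → X ⊆ₗ X′ → vertices (at X′) ⊆ vertices (at X)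

  open Direction public using (at)

  infix 4 _≈_

  _≈_ : Direction → Direction → Set ℓ
  f ≈ h = ∀ X → vertices (at f X) ≐ vertices (at h X)

  DirectionalChoice : Set (lsuc ℓ)
  DirectionalChoice = Σ (List Vertex) Component

  choiceSetoid : Setoid (lsuc ℓ) ℓ
  choiceSetoid = record
    { Carrier       = DirectionalChoice
    ; _≈_           = λ (X , C) (Y , D) →
                      X ∼[ set ] Y × vertices C ≐ vertices D
    ; isEquivalence = record
      { refl  = LS.refl , ≐-refl
      ; sym   = λ (p , q) → LS.sym p , ≐-sym q
      ; trans = λ (p , q) (p′ , q′) → LS.trans p p′ , ≐-trans q q′
      }
    }
    where module LS = Setoid ([ set ]-Equality Vertex)

  subsetSetoid : Pred DirectionalChoice ℓ → Setoid (lsuc ℓ) ℓ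
  subsetSetoid S = On.setoid {B = Σ DirectionalChoice S} choiceSetoid proj₁

  Distinguishes : DirectionalChoice → Direction → Direction → Set ℓ
  Distinguishes (X , C) f h =
    vertices (at f X) ≐ vertices C × ¬ (vertices (at h X) ≐ vertices C)

  DistinguishesFromOthers : Pred DirectionalChoice ℓ → Direction → Set (lsuc ℓ)
  DistinguishesFromOthers S f =
    ∀ h → ¬ (h ≈ f) → ∃ λ c → c ∈ S × Distinguishes c f h

  CountablyDetermined : Direction → Set (lsuc ℓ)
  CountablyDetermined f = ∃ λ (S : Pred DirectionalChoice ℓ) →
    Countable (subsetSetoid S) × DistinguishesFromOthers S f

  record Ray : Set ℓ where
    field
      vertex     : ℕ → Vertex
      injective  : ∀ {m n} → vertex m ≡ vertex n → m ≡ n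
      adjacent   : ∀ n → Adj (vertex n) (vertex (suc n))

  open Ray public using (vertex)

  ContainsTail : Pred Vertex ℓ → Ray → Set ℓ
  ContainsTail C R = ∃ λ n → ∀ m → n ≤ m → vertex R m ∈ C

  -- Distinct components of G - X are disjoint, so at most one contains a
  -- tail of R, and any two directions induced by R are equal.
  Induces : Ray → Direction → Set ℓ
  Induces R f = ∀ X → ContainsTail (vertices (at f X)) R

  -- The directional choices defined by the finite initial segments of R,
  -- whose vertex sets are the sets {R₀, …, Rₙ}.
  InitialChoices : Ray → Pred DirectionalChoice ℓ
  InitialChoices R (X , C) =
    (∃ λ n → X ∼[ set ] applyUpTo (vertex R) (suc n)) ×
    (∀ m → vertex R m ∉ₗ X → vertex R m ∈ vertices C)

  Directional : Ray → Set (lsuc ℓ)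
  Directional R = ∃ λ (f : Direction) →
    Induces R f × DistinguishesFromOthers (InitialChoices R) f

{-# OPTIONS --safe #-}
module Submission where

-- (i) ⇒ (ii).  Let U be the countable union of the sets X of the given choices.
-- If a path has vertex set X, its last vertex has a neighbour in f(X), and
-- y ∈ f(X), then the path can be extended along a path to y inside f(X): stop at
-- the first vertex whose addition to X pushes y out of f(X).  This vertex was in
-- the previous component and hence has a neighbour in the new one.  So there
-- is a ray R such that R - X ⊆ f(X) for every initial segment X of R and every
-- u ∈ U lies outside f(X) for some such X.  A direction h that agrees with f on
-- the initial segments of R then agrees with f on every set X of the given
-- choices, because some f(X′) = h(X′) avoids X, and so h = f.  Applying this to
-- the direction induced by R shows that R induces f.

open import Defs
open import Axiom.ExcludedMiddle using (ExcludedMiddle)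
open import Data.List.Base using (List; []; _∷_; _++_; applyUpTo; applyDownFrom)
open import Data.List.Membership.Propositional
  using () renaming (_∈_ to _∈ₗ_; _∉_ to _∉ₗ_)
open import Data.List.Membership.Propositional.Properties
  using (∈-applyUpTo⁺; ∈-applyUpTo⁻; ∈-applyDownFrom⁺; ∈-applyDownFrom⁻)
open import Data.List.Relation.Binary.BagAndSetEquality using (_∼[_]_; set; [_]-Equality)
open import Data.List.Relation.Binary.Subset.Propositional
  using () renaming (_⊆_ to _⊆ₗ_)
open import Data.List.Relation.Binary.Subset.Propositional.Properties
  using (xs⊆xs++ys; xs⊆ys++xs; xs⊆x∷xs)
open import Data.List.Relation.Unary.Any using (here; there)
open import Data.Nat.Base using (ℕ; zero; suc; _≤_; _<_; _⊔_; _≤′_; ≤′-refl; ≤′-step)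
import Data.Nat.Properties as ℕ
open import Data.Product.Base using (∃; _×_; _,_; proj₁; proj₂; map₂)
open import Data.Sum.Base using (_⊎_; inj₁; inj₂; [_,_]′)
open import Function.Base using (id; _∘_; case_of_)
open import Function.Bundles using (Injection; _⇔_; mk⇔; Equivalence)
open import Level using (Level; Lift; lift; lower) renaming (suc to lsuc)
open import Relation.Binary.Construct.Closure.ReflexiveTransitive
  using (Star; ε; _◅_; _◅◅_; gmap; reverse)
open import Relation.Binary.Bundles using (Setoid)
open import Relation.Binary.Core using (Rel)
open import Relation.Binary.Definitions using (tri<; tri≈; tri>)
open import Relation.Binary.PropositionalEquality
  using (_≡_; refl; sym; trans; cong; subst)
open import Relation.Nullary using (¬_; Dec; yes; no; contradiction)
open import Relation.Nullary.Decidable using (map′; decidable-stable)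
open import Relation.Unary using (Pred; _∈_; _∉_; _⊆_; _≐_)
open import Relation.Unary.Properties using (≐-sym; ≐-trans)

-- Joining infinitely many finite runs into one sequence.

module _ {a r} {A : Set a} {_⟶_ : Rel A r} (stage : ℕ → A)
  (run : ∀ n → ∃ λ c → stage n ⟶ c × Star _⟶_ c (stage (suc n))) where

  private
    -- What remains of the run to `stage n`. Runs are nonempty, so at the end of one, too, `advance`
    -- makes exactly one step: the first of the next run.
    Pending : Set _
    Pending = ∃ λ n → ∃ λ b → Star _⟶_ b (stage n)

    current : Pending → A
    current = proj₁ ∘ proj₂

    advance : Pending → Pending
    advance (n , _ , ε)      = suc n , proj₁ (run n) , proj₂ (proj₂ (run n))
    advance (n , _ , _ ◅ rs) = n , _ , rs

    advance-step : ∀ p → current p ⟶ current (advance p)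
    advance-step (n , _ , ε)     = proj₁ (proj₂ (run n))
    advance-step (n , _ , r ◅ _) = r

    pending : ℕ → Pending
    pending zero    = zero , stage zero , ε
    pending (suc m) = advance (pending m)

    drain : ∀ {n b} (rs : Star _⟶_ b (stage n)) m → pending m ≡ (n , b , rs) →
            ∃ λ m′ → pending m′ ≡ (n , stage n , ε)
    drain ε        m eq = m , eq
    drain (_ ◅ rs) m eq = drain rs (suc m) (cong advance eq)

    visit : ∀ n → ∃ λ m → pending m ≡ (n , stage n , ε)
    visit zero    = zero , refl
    visit (suc n) with visit n
    ... | m , eq = drain _ (suc m) (cong advance eq)

  interpolate : ∃ λ (s : ℕ → A) → s 0 ≡ stage 0 ×
    (∀ m → s m ⟶ s (suc m)) × (∀ n → ∃ λ m → s m ≡ stage n)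
  interpolate = current ∘ pending , refl , advance-step ∘ pending ,
    λ n → map₂ (cong current) (visit n)

module _ {ℓ : Level} (G : Graph ℓ) where
  open Graph G
  open Component using (nonempty; avoids; connected; maximal)
  open Direction using (antitone)
  open Setoid ([ set ]-Equality Vertex) using ()
    renaming (refl to ∼-refl; sym to ∼-sym; trans to ∼-trans)

  -- Comparing components after deleting different finite sets.

  adjacent-closed : ∀ {X} (C : Component G X) {u v} →
    u ∈ vertices C → Adj u v → v ∉ₗ X → v ∈ vertices C
  adjacent-closed C u∈C uv v∉X = maximal C u∈C ((uv , avoids C u∈C , v∉X) ◅ ε)

  -- A walk inside `C` from the common vertex avoids `Y`, so it cannot leave `D`.
  meeting⇒⊆ : ∀ {X Y} (C : Component G X) (D : Component G Y) →
    (∀ {v} → v ∈ vertices C → v ∉ₗ Y) →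
    ∀ {u} → u ∈ vertices C → u ∈ vertices D → vertices C ⊆ vertices D
  meeting⇒⊆ {X} C D C-avoids-Y u∈C u∈D w∈C = follow (connected C u∈C w∈C) u∈C u∈D
    where
    follow : ∀ {u w} → Star (AdjAvoiding G X) u w →
             u ∈ vertices C → u ∈ vertices D → w ∈ vertices D
    follow ε _ u∈D = u∈D
    follow ((uv , _ , v∉X) ◅ walk) u∈C u∈D = follow walk v∈C
      (adjacent-closed D u∈D uv (C-avoids-Y v∈C))
      where v∈C = adjacent-closed C u∈C uv v∉X

  meeting⇒≐ : ∀ {X Y} (C : Component G X) (D : Component G Y) → X ∼[ set ] Y →
    ∀ {u} → u ∈ vertices C → u ∈ vertices D → vertices C ≐ vertices D
  meeting⇒≐ C D X∼Y u∈C u∈D =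
    meeting⇒⊆ C D (λ v∈C → avoids C v∈C ∘ Equivalence.from X∼Y) u∈C u∈D ,
    meeting⇒⊆ D C (λ v∈D → avoids D v∈D ∘ Equivalence.to X∼Y) u∈D u∈C

  -- The component `at f (X ++ Y)` lies in both `at f X` and `at f Y`, so `C` meets `at f Y`.
  ⊆-at : (f : Direction G) → ∀ {X} (C : Component G X) Y →
    vertices (at f X) ≐ vertices C → (∀ {v} → v ∈ vertices C → v ∉ₗ Y) →
    vertices C ⊆ vertices (at f Y)
  ⊆-at f {X} C Y (fX⊆C , _) C-avoids-Y
    with u , u∈ ← nonempty (at f (X ++ Y)) =
    meeting⇒⊆ C (at f Y) C-avoids-Y
      (fX⊆C (antitone f (xs⊆xs++ys X Y) u∈)) (antitone f (xs⊆ys++xs Y X) u∈)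

  -- Rays and the choices defined by their initial segments.

  module _ (R : Ray G) where
    open Ray R using (injective; adjacent) renaming (vertex to r)

    segment : ℕ → List Vertex
    segment = applyUpTo r

    avoids-segment : ∀ {m n} → n ≤ m → r m ∉ₗ segment n
    avoids-segment n≤m rm∈ with _ , i<n , eq ← ∈-applyUpTo⁻ r rm∈ =
      ℕ.<⇒≢ (ℕ.<-≤-trans i<n n≤m) (sym (injective eq))

    segment-mono : ∀ {m n} → m ≤ n → segment m ⊆ₗ segment n
    segment-mono m≤n v∈ with _ , i<m , refl ← ∈-applyUpTo⁻ r v∈ =
      ∈-applyUpTo⁺ r (ℕ.<-≤-trans i<m m≤n)

    segment-⊆⇒≤ : ∀ {m n} → segment m ⊆ₗ segment n → m ≤ n
    segment-⊆⇒≤ {m} {n} seg⊆ = ℕ.≮⇒≥ λ n<m →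
      avoids-segment ℕ.≤-refl (seg⊆ (∈-applyUpTo⁺ r n<m))

    tail-walk : ∀ {X m n} → m ≤ n → (∀ k → m ≤ k → r k ∉ₗ X) →
                Star (AdjAvoiding G X) (r m) (r n)
    tail-walk {X} {m} m≤n r∉X = walk (ℕ.≤⇒≤′ m≤n)
      where
      walk : ∀ {n} → m ≤′ n → Star (AdjAvoiding G X) (r m) (r n)
      walk ≤′-refl = ε
      walk (≤′-step m≤′n) = walk m≤′n ◅◅
        ((adjacent _ , r∉X _ (ℕ.≤′⇒≤ m≤′n) ,
          r∉X _ (ℕ.≤′⇒≤ (≤′-step m≤′n))) ◅ ε)

    induced-unique : ∀ {f h} → Induces G R f → Induces G R h → _≈_ G f h
    induced-unique {f} {h} Rf Rh X with m , tf ← Rf X | n , th ← Rh X =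
      meeting⇒≐ (at f X) (at h X) ∼-refl
        (tf (m ⊔ n) (ℕ.m≤m⊔n m n)) (th (m ⊔ n) (ℕ.m≤n⊔m m n))

    initialChoices-countable : Countable (subsetSetoid G (InitialChoices G R))
    initialChoices-countable = record
      { to        = λ (_ , (n , _) , _) → n
      ; cong      = λ { {_ , (_ , X∼) , _} {_ , (_ , Y∼) , _} (X∼Y , _) →
          let seg∼ = ∼-trans (∼-sym X∼) (∼-trans X∼Y Y∼) in
          ℕ.suc-injective (ℕ.≤-antisym
            (segment-⊆⇒≤ (Equivalence.to seg∼))
            (segment-⊆⇒≤ (Equivalence.from seg∼))) }
      ; injective = λ { {(_ , C) , (n , X∼) , rC} {(_ , D) , (_ , Y∼) , rD} refl →
          let X∼Y = ∼-trans X∼ (∼-sym Y∼)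
              -- The vertex `r (suc n)` is outside both sets, hence in both components.
              fresh = avoids-segment {suc n} ℕ.≤-refl
          in X∼Y , meeting⇒≐ C D X∼Y
               (rC (suc n) (fresh ∘ Equivalence.to X∼))
               (rD (suc n) (fresh ∘ Equivalence.to Y∼)) }
      }

  -- `Directional` brings its own direction `f′`, which agrees with `f` because `R` induces both.
  directional⇒countablyDetermined : (f : Direction G) →
    (∃ λ R → Directional G R × Induces G R f) → CountablyDetermined G f
  directional⇒countablyDetermined f (R , (f′ , Rf′ , distinguish) , Rf) =
    InitialChoices G R , initialChoices-countable R , λ h h≉f →
      let (c , c∈ , f′≐ , h≭) = distinguish h (λ h≈f′ →
            h≉f λ X → ≐-trans (h≈f′ X) (f′≈f X))
      in c , c∈ , ≐-trans (≐-sym (f′≈f (proj₁ c))) f′≐ , h≭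
    where
    f′≈f : _≈_ G f′ f
    f′≈f = induced-unique R {f′} {f} Rf′ Rf

  module _ (em : ExcludedMiddle (lsuc ℓ)) where

    decide : (P : Set ℓ) → Dec P
    decide P = map′ lower lift (em {Lift (lsuc ℓ) P})

    -- The direction induced by a ray.

    module _ (R : Ray G) where
      open Ray R using (injective) renaming (vertex to r)

      eventually-avoids : ∀ X → ∃ λ n → ∀ m → n ≤ m → r m ∉ₗ X
      eventually-avoids []      = 0 , λ _ _ ()
      eventually-avoids (x ∷ X) with eventually-avoids X | decide (∃ λ i → r i ≡ x)
      ... | n , r∉X | no ∄i = n , λ
        { m _   (here eq)   → ∄i (m , eq)
        ; m n≤m (there rm∈) → r∉X m n≤m rm∈ }
      ... | n , r∉X | yes (i , refl) = suc i ⊔ n , λ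
        { m ≤m (here eq)   → ℕ.<⇒≢ (ℕ.≤-trans (ℕ.m≤m⊔n (suc i) n) ≤m) (sym (injective eq))
        ; m ≤m (there rm∈) → r∉X m (ℕ.≤-trans (ℕ.m≤n⊔m (suc i) n) ≤m) rm∈ }

      private
        -- With `n` existential, antitonicity can keep the same `n`, and two different starting
        -- vertices are joined along the ray.
        InTail : List Vertex → Pred Vertex ℓ
        InTail X v = ∃ λ n → (∀ m → n ≤ m → r m ∉ₗ X) × Star (AdjAvoiding G X) (r n) v

        tail-nonempty : ∀ X → ∃ (InTail X)
        tail-nonempty X with n , r∉X ← eventually-avoids X = r n , n , r∉X , ε

        walk-avoids : ∀ {X u v} → u ∉ₗ X → Star (AdjAvoiding G X) u v → v ∉ₗ X
        walk-avoids u∉X ε                    = u∉X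
        walk-avoids _ ((_ , _ , v∉X) ◅ walk) = walk-avoids v∉X walk

        back : ∀ {X u v} → Star (AdjAvoiding G X) u v → Star (AdjAvoiding G X) v u
        back = reverse λ (uv , u∉X , v∉X) → adj-sym uv , v∉X , u∉X

      inducedDirection : Direction G
      inducedDirection = record
        { at = λ X → record
          { vertices  = InTail X
          ; nonempty  = tail-nonempty X
          ; avoids    = λ (n , r∉X , walk) → walk-avoids (r∉X n ℕ.≤-refl) walk
          ; connected = λ { (m , rm∉X , u) (n , rn∉X , v) →
              back u ◅◅ [ (λ m≤n → tail-walk R m≤n rm∉X)
                        , (λ n≤m → back (tail-walk R n≤m rn∉X)) ]′ (ℕ.≤-total m n)
                     ◅◅ v }
          ; maximal   = λ (n , r∉X , walk) walk′ → n , r∉X , walk ◅◅ walk′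
          }
        ; antitone = λ X⊆X′ (n , r∉X′ , walk) →
            n , (λ m n≤m → r∉X′ m n≤m ∘ X⊆X′) ,
            gmap id (λ (uv , u∉ , v∉) → uv , u∉ ∘ X⊆X′ , v∉ ∘ X⊆X′) walk
        }

      inducedDirection-induced : Induces G R inducedDirection
      inducedDirection-induced X with n , r∉X ← eventually-avoids X =
        n , λ m n≤m → n , r∉X , tail-walk R n≤m r∉X

    -- Extending a path inside the components of a direction.

    module _ (f : Direction G) where

      -- The path built so far ends in `next`; its earlier vertices are `visited`, latest first.
      record Position : Set ℓ where
        constructor position
        field
          visited : List Vertex
          next    : Vertex
          next∈   : next ∈ vertices (at f visited)

      open Position

      _⟶_ : Rel Position ℓ
      p ⟶ q = visited q ≡ next p ∷ visited p × Adj (next p) (next q)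

      antitone-∷ : ∀ {v X} → vertices (at f (v ∷ X)) ⊆ vertices (at f X)
      antitone-∷ {v} {X} = antitone f (xs⊆x∷xs X v)

      -- As `a` avoids `X`, the only vertex of `v ∷ X` that it can equal is `v`.
      adjacent-closed-∷ : ∀ {v X a m} → a ∈ vertices (at f X) → Adj a m →
        m ∈ vertices (at f (v ∷ X)) → a ≡ v ⊎ a ∈ vertices (at f (v ∷ X))
      adjacent-closed-∷ {v} {X} {a} a∈ am m∈ with decide (a ≡ v)
      ... | yes a≡v = inj₁ a≡v
      ... | no  a≢v = inj₂ (adjacent-closed (at f (v ∷ X)) m∈ (adj-sym am)
        λ { (here a≡v) → a≢v a≡v ; (there a∈X) → avoids (at f X) a∈ a∈X })

      -- The index is an upper bound on the length. `exclude-along` recurses on it, since a pruned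
      -- walk is not a subterm of the original.
      data Walk (P : Pred Vertex ℓ) (y : Vertex) : ℕ → Vertex → Set ℓ where
        stop : ∀ {k} → y ∈ P → Walk P y k y
        step : ∀ {k u v} → u ∈ P → Adj u v → Walk P y k v → Walk P y (suc k) u

      start∈ : ∀ {P y k u} → Walk P y k u → u ∈ P
      start∈ (stop y∈)     = y∈
      start∈ (step u∈ _ _) = u∈

      weaken : ∀ {P y k u} → Walk P y k u → Walk P y (suc k) u
      weaken (stop y∈)      = stop y∈
      weaken (step u∈ uv w) = step u∈ uv (weaken w)

      walk-in : ∀ {X} (C : Component G X) {u y} → u ∈ vertices C → y ∈ vertices C →
        ∃ λ k → Walk (vertices C) y k u
      walk-in {X} C {y = y} u∈C y∈C = inside u∈C (connected C u∈C y∈C)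
        where
        inside : ∀ {u} → u ∈ vertices C → Star (AdjAvoiding G X) u y →
                 ∃ λ k → Walk (vertices C) y k u
        inside u∈C ε = 0 , stop u∈C
        inside u∈C ((uv , _ , v∉X) ◅ walk)
          with k , w ← inside (adjacent-closed C u∈C uv v∉X) walk =
          suc k , step u∈C uv w

      -- Keeps the part of the walk after its last visit to v.
      prune : ∀ {X v y k a} → y ∈ vertices (at f (v ∷ X)) → Walk (vertices (at f X)) y k a →
        Walk (vertices (at f (v ∷ X))) y k a ⊎
        ∃ λ v′ → Adj v v′ × Walk (vertices (at f (v ∷ X))) y k v′
      prune y∈ (stop _) = inj₁ (stop y∈)
      prune y∈ (step a∈ am w) with prune y∈ w
      ... | inj₂ (v′ , vv′ , w′) = inj₂ (v′ , vv′ , weaken w′)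
      ... | inj₁ w′ with adjacent-closed-∷ a∈ am (start∈ w′)
      ...   | inj₁ refl = inj₂ (_ , am , weaken w′)
      ...   | inj₂ a∈′  = inj₁ (step a∈′ am w′)

      -- Prune a walk in `at f X` from `v` to some vertex of `at f (v ∷ X)`. It starts at `v`, so a
      -- last visit to `v` exists, and the vertex after it is the new `next`.
      continue : ∀ p → ∃ λ q → p ⟶ q
      continue (position X v v∈)
        with w , w∈ ← nonempty (at f (v ∷ X))
        with _ , walk ← walk-in (at f X) v∈ (antitone-∷ w∈)
        with prune w∈ walk
      ... | inj₁ walk′            =
        contradiction (here refl) (avoids (at f (v ∷ X)) (start∈ walk′))
      ... | inj₂ (v′ , vv′ , walk′) = position (v ∷ X) v′ (start∈ walk′) , refl , vv′

      Excludes : List Vertex → Position → Set ℓ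
      Excludes L p = ∀ {y} → y ∈ₗ L → y ∉ vertices (at f (visited p))

      excludes-⟶* : ∀ {L p q} → Star _⟶_ p q → Excludes L p → Excludes L q
      excludes-⟶* ε                excl = excl
      excludes-⟶* {L} {q = q} (_◅_ {j = position _ _ _} (refl , _) s) excl =
        excludes-⟶* {L} {q = q} s λ y∈L → excl y∈L ∘ antitone-∷

      -- The path follows the walk while `y` stays in the component. Adding `y` itself would exclude
      -- it, so this ends at `y` at the latest.
      exclude-along : ∀ {y} k p → Walk (vertices (at f (visited p))) y k (next p) →
        ∃ λ q → Star _⟶_ p q × y ∉ vertices (at f (visited q))
      exclude-along {y} k p@(position X v _) walk
        with decide (y ∈ vertices (at f (v ∷ X)))
      ... | no y∉ with continue p
      ...   | q@(position _ _ _) , s@(refl , _) = q , s ◅ ε , y∉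
      exclude-along k p (stop _) | yes y∈ =
        contradiction (here refl) (avoids (at f _) y∈)
      exclude-along (suc k) p@(position X v _) (step _ vm walk) | yes y∈ =
        -- Either the rest of the walk stays in the new component and its first vertex comes next,
        -- or the vertex after the last return to `v` does. The bound drops to `k` in both cases.
        let (v′ , vv′ , walk′) = [ (λ w → _ , vm , w) , id ]′ (prune y∈ walk)
            (q , s , y∉) = exclude-along k (position (v ∷ X) v′ (start∈ walk′)) walk′
        in q , (refl , vv′) ◅ s , y∉

      exclude : ∀ L p → ∃ λ q → Star _⟶_ p q × Excludes L q
      exclude []      p = p , ε , λ ()
      exclude (y ∷ L) p with exclude L p
      ... | q , s , excl with decide (y ∈ vertices (at f (visited q)))
      ...   | no y∉  = q , s , λ { (here refl) → y∉ ; (there z∈L) → excl z∈L }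
      ...   | yes y∈ with k , walk ← walk-in (at f (visited q)) (next∈ q) y∈
                     with q′ , s′ , y∉ ← exclude-along k q walk =
        q′ , s ◅◅ s′ , λ
          { (here refl) → y∉
          ; (there z∈L) → excludes-⟶* {L} {q} {q′} s′ excl z∈L }

      ray-excluding : (L : ℕ → List Vertex) → ∃ λ (R : Ray G) →
        (∀ m → vertex R m ∈ vertices (at f (segment R m))) ×
        (∀ n → ∃ λ m → ∀ {y} → y ∈ₗ L n → y ∉ vertices (at f (segment R m)))
      ray-excluding L = R , next∈segment , λ n →
        -- `L n` is excluded on the way from `stage n` to `stage (suc n)`.
        let (m , eq) = hits (suc n)
            excl = proj₂ (proj₂ (extend n (stage n)))
        in m , λ y∈L y∈f → subst (Excludes (L n)) (sym eq) excl y∈L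
             (antitone f (visited⊆segment m) y∈f)
        where
        extend : ∀ n p → ∃ λ q → (∃ λ c → p ⟶ c × Star _⟶_ c q) × Excludes (L n) q
        -- The step to `c` keeps the run nonempty even if `L n` is already excluded at `p`.
        extend n p with c , s ← continue p with q , s* , excl ← exclude (L n) c =
          q , (c , s , s*) , excl

        stage : ℕ → Position
        stage zero    = position [] _ (proj₂ (nonempty (at f [])))
        stage (suc n) = proj₁ (extend n (stage n))

        interpolated = interpolate {_⟶_ = _⟶_} stage λ n →
          proj₁ (proj₂ (extend n (stage n)))

        p : ℕ → Position
        p = proj₁ interpolated

        steps : ∀ m → p m ⟶ p (suc m)
        steps = proj₁ (proj₂ (proj₂ interpolated))

        hits : ∀ n → ∃ λ m → p m ≡ stage n
        hits = proj₂ (proj₂ (proj₂ interpolated))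

        r : ℕ → Vertex
        r = next ∘ p

        visited≡ : ∀ m → visited (p m) ≡ applyDownFrom r m
        visited≡ zero    = cong visited (proj₁ (proj₂ interpolated))
        visited≡ (suc m) = trans (proj₁ (steps m)) (cong (r m ∷_) (visited≡ m))

        -- `next` avoids `visited`, which holds all earlier vertices.
        distinct : ∀ {m n} → m < n → ¬ (r m ≡ r n)
        distinct {m} {n} m<n eq = avoids (at f (visited (p n))) (next∈ (p n))
          (subst (r n ∈ₗ_) (sym (visited≡ n))
            (subst (_∈ₗ applyDownFrom r n) eq (∈-applyDownFrom⁺ r m<n)))

        R : Ray G
        R = record
          { vertex    = r
          ; injective = λ {m} {n} eq → case ℕ.<-cmp m n of λ
              { (tri< m<n _ _) → contradiction eq (distinct m<n)
              ; (tri≈ _ m≡n _) → m≡n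
              ; (tri> _ _ n<m) → contradiction (sym eq) (distinct n<m) }
          ; adjacent  = proj₂ ∘ steps
          }

        visited⊆segment : ∀ m → visited (p m) ⊆ₗ segment R m
        visited⊆segment m v∈
          with _ , i<m , refl ← ∈-applyDownFrom⁻ r (subst (_ ∈ₗ_) (visited≡ m) v∈) =
          ∈-applyUpTo⁺ r i<m

        segment⊆visited : ∀ m → segment R m ⊆ₗ visited (p m)
        segment⊆visited m v∈ with _ , i<m , refl ← ∈-applyUpTo⁻ r v∈ =
          subst (_ ∈ₗ_) (sym (visited≡ m)) (∈-applyDownFrom⁺ r i<m)

        next∈segment : ∀ m → r m ∈ vertices (at f (segment R m))
        next∈segment m = antitone f (segment⊆visited m) (next∈ (p m))

      -- From countably many choices to a directional ray.

      module _ {S : Pred (DirectionalChoice G) ℓ} (countable : Countable (subsetSetoid G S))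
        where
        open Injection countable using (to; injective)

        choiceSet : ℕ → List Vertex
        -- Choices contain components, so this instance of excluded middle lives at level `lsuc ℓ`.
        choiceSet n with em {∃ λ c → to c ≡ n}
        ... | yes (((X , _) , _) , _) = X
        -- Outside the image of `to` there is nothing to exclude.
        ... | no _                    = []

        -- The preimage picked by `em` need not be `c`, but injectivity gives it the same vertex
        -- set.
        ⊆-choiceSet : ∀ c → proj₁ (proj₁ c) ⊆ₗ choiceSet (to c)
        ⊆-choiceSet c with em {∃ λ c′ → to c′ ≡ to c}
        ... | yes (c′ , eq) = Equivalence.from (proj₁ (injective {c′} {c} eq))
        ... | no ∄          = contradiction (c , refl) ∄

      countablyDetermined⇒directional : CountablyDetermined G f →
        ∃ λ R → Directional G R × Induces G R f
      countablyDetermined⇒directional (S , countable , distinguish)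
        with R , r∈ , excludes ← ray-excluding (choiceSet countable) =
        R , (f , R-induces-f , initial-distinguish) , R-induces-f
        where
        -- Otherwise a given choice `(X , C)` tells `h` from `f`. For some segment `Y`, the common
        -- component at `Y` avoids `X`, so it lies in both `at h X` and `at f X`, which therefore
        -- coincide.
        agree⇒≈ : ∀ h →
          (∀ m → vertices (at h (segment R m)) ≐ vertices (at f (segment R m))) →
          _≈_ G h f
        agree⇒≈ h agree = decidable-stable (decide _) λ h≉f →
          let (c@(X , C) , c∈S , fX≐C , hX≭C) = distinguish h h≉f
              (m , excl) = excludes (Injection.to countable (c , c∈S))
              Y = segment R m
              fY-avoids : ∀ {v} → v ∈ vertices (at f Y) → v ∉ₗ X
              fY-avoids v∈ v∈X = excl (⊆-choiceSet countable (c , c∈S) v∈X) v∈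
              inhX = ⊆-at h (at f Y) X (agree m) fY-avoids (r∈ m)
              infX = ⊆-at f (at f Y) X (id , id) fY-avoids (r∈ m)
          in hX≭C (≐-trans (meeting⇒≐ (at h X) (at f X) ∼-refl inhX infX) fX≐C)

        R-induces-f : Induces G R f
        R-induces-f X =
          let (n , tail) = inducedDirection-induced R X
          in n , λ m n≤m → proj₁ (induced≈f X) (tail m n≤m)
          where
          induced≈f : _≈_ G (inducedDirection R) f
          induced≈f = agree⇒≈ (inducedDirection R) λ m →
            meeting⇒≐ (at (inducedDirection R) (segment R m)) (at f (segment R m)) ∼-refl
              -- The common vertex is `vertex R m`, the first one after the segment.
              (m , (λ k m≤k → avoids-segment R m≤k) , ε) (r∈ m)

        initial-choice : ∀ n → (segment R (suc n) , at f (segment R (suc n))) ∈ InitialChoices G R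
        initial-choice n = (n , ∼-refl) , λ m rm∉ →
          -- A vertex of `R` outside the segment has index at least `suc n`, and its own segment
          -- contains this one.
          antitone f (segment-mono R (ℕ.≮⇒≥ (rm∉ ∘ ∈-applyUpTo⁺ (vertex R)))) (r∈ m)

        initial-distinguish : DistinguishesFromOthers G (InitialChoices G R) f
        initial-distinguish h h≉f
          with decide (∃ λ n → ¬ (vertices (at h (segment R (suc n))) ≐
                                  vertices (at f (segment R (suc n)))))
        ... | yes (n , h≭f) =
          (segment R (suc n) , at f (segment R (suc n))) , initial-choice n , (id , id) , h≭f
        ... | no ∄n = contradiction (agree⇒≈ h agree) h≉f
          where
          agree : ∀ m → vertices (at h (segment R m)) ≐ vertices (at f (segment R m))
          agree (suc n) = decidable-stable (decide _) λ h≭f → ∄n (n , h≭f)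
          -- The empty set defines no initial choice; `vertex R 1`, common to both components at
          -- `segment R 1`, settles this case.
          agree zero    = meeting⇒≐ (at h []) (at f []) ∼-refl
            (antitone h []⊆ (proj₂ (agree 1) (r∈ 1))) (antitone f []⊆ (r∈ 1))
            where
            []⊆ : [] ⊆ₗ segment R 1
            []⊆ ()

theorem1 : ∀ {ℓ} → ExcludedMiddle (lsuc ℓ) →
    (G : Graph ℓ) (f : Direction G) →
    CountablyDetermined G f ⇔ (∃ λ (R : Ray G) → Directional G R × Induces G R f)
theorem1 em G f = mk⇔ (countablyDetermined⇒directional G em f)
                      (directional⇒countablyDetermined G f)
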